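{- Let $A,B,C$ be integers with $ABC\neq 0$ and let $f(X)=AX+B+\frac{C}{X}$. Then the equation $f(x)f(y)=f(z)^2$ has infinitely many nontrivial rational solutions $(x,y,z)$.
   Context: A solution $(x,y,z)$ (with $x,y,z$ nonzero rationals, so that $f$ is defined) of $f(x)f(y)=f(z)^2$ is called nontrivial if $f(x)\neq f(y)$ and $f(z)\neq 0$. -}

module Defs where

open import Data.Integer.Base using (ℤ)
open import Data.List.Base using (List)
open import Data.List.Membership.Propositional using (_∉_)
open import Data.Product.Base using (∃; _×_; _,_)
open import Data.Rational.Base using (ℚ; 0ℚ; NonZero; _+_; _*_; _÷_; _/_)
open import Level using (Level; _⊔_; 0ℓ)
open import Relation.Binary.PropositionalEquality using (_≡_; _≢_)
open import Relation.Unary using (Pred)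

private
  variable
    a p : Level

f : (A B C : ℤ) (X : ℚ) → .{{NonZero X}} → ℚ
f A B C X = (A / 1) * X + B / 1 + (C / 1) ÷ X

record NontrivialSolution (A B C : ℤ) (x y z : ℚ) : Set where
  field
    {{x-nonZero}} : NonZero x
    {{y-nonZero}} : NonZero y
    {{z-nonZero}} : NonZero z
    equation : f A B C x * f A B C y ≡ f A B C z * f A B C z
    fx≢fy    : f A B C x ≢ f A B C y
    fz≢0     : f A B C z ≢ 0ℚ

-- Every finite list of elements misses some element satisfying P. Iterating
-- this yields an injective sequence of elements of P, so it is the positive
-- form of "P is not finite".
Infinite : {S : Set a} → Pred S p → Set (a ⊔ p)
Infinite {S = S} P = (xs : List S) → ∃ λ s → P s × s ∉ xs

NontrivialSolutions : (A B C : ℤ) → Pred (ℚ × ℚ × ℚ) 0ℓ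
NontrivialSolutions A B C (x , y , z) = NontrivialSolution A B C x y z

{-# OPTIONS --safe #-}

-- Replacing X by (B/A)X turns f into a multiple of X + 1 + c/X with c = AC/B²; put d = 1/c.
--
-- On xy = z² the equation reduces, with x = −c r², y = −c k², z = c r k, to (r − k)² = d + r²k².
-- Its solutions correspond to the rational points of h² = r⁴ − d r² + d, a double cover of
-- Y² = X³ − d X² + d X by X = r², and r = ±1 is such a point. Doubling a point whose r has a large
-- enough power of 2 in its denominator lowers the 2-adic valuation of r by one, so such a
-- point has infinitely many distinct multiples. One of the second, third or fourth multiples of
-- r = 1 is of this kind unless that point is torsion, which happens exactly for d = 1, −1, 3.
--
-- For these three d, fix z = c₁/c₂ instead. A Möbius change of variables x ↦ α, y ↦ β brings
-- f(x) f(y) = f(z)² into the form α + β + μ(1/α + 1/β) = const, again an elliptic curve on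
-- which the same 2-adic doubling argument works, now starting from an explicit point.
module Submission where

open import Data.Empty using (⊥; ⊥-elim; ⊥-elim-irr)
open import Data.Integer.Base using (ℤ; 0ℤ; 1ℤ; +_; -[1+_]; _+_; _-_; _*_; -_; _^_; ∣_∣; ≢-nonZero)
open import Data.Integer.Divisibility.Signed
  using (_∣_; divides; ∣-trans; ∣m∣n⇒∣m+n; ∣m⇒∣-m; ∣m⇒∣m*n; ∣n⇒∣m*n; *-monoʳ-∣; ∣⇒∣ᵤ)
open import Data.Integer.GCD using (gcd)
import Data.Integer.Properties as ℤ
open import Data.Integer.Solver using (module +-*-Solver)
open import Data.List.Base using (map)
open import Data.List.Extrema.Nat using (max; xs≤max)
open import Data.List.Membership.Propositional.Properties using (∈-map⁺)
import Data.List.Relation.Unary.All as All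
import Data.Nat.Base as ℕ
open ℕ using (ℕ; zero; suc)
open import Data.Nat.Coprimality using (Coprime; 1-coprimeTo)
import Data.Nat.Coprimality as Coprime
import Data.Nat.Properties as ℕ
open import Data.Product.Base using (∃; ∃₂; _×_; _,_; proj₁; proj₂)
import Data.Rational.Base as ℚ
open ℚ using (ℚ; 0ℚ; 1ℚ; ↥_; ↧_; mkℚ; 1/_; _/_)
import Data.Rational.Properties as ℚ
import Data.Rational.Solver
module ℚ-Solver = Data.Rational.Solver.+-*-Solver
open import Data.Rational.Unnormalised.Base using (mkℚᵘ; *≡*)
open import Data.Sum.Base using (_⊎_; inj₁; inj₂; [_,_]′)
open import Function.Base using (_∘_)
open import Relation.Binary.PropositionalEquality
open import Relation.Nullary.Decidable.Core using (yes; no)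
open import Relation.Unary using (Pred)
open import Defs

open +-*-Solver

-- Integer identities modulo hypotheses

x-y≡0⇒x≡y : ∀ {x y} → x - y ≡ 0ℤ → x ≡ y
x-y≡0⇒x≡y {x} {y} = ℤ.i-j≡0⇒i≡j x y

-- The ring solver proves only unconditional identities. A hypothesis `i ≡ j` is used by exhibiting
-- `l - r` as a cofactor `c` times `i - j`, which the solver can check.
≡-by-multiple : ∀ {l r} c {i j} → i ≡ j → l - r ≡ c * (i - j) → l ≡ r
≡-by-multiple c {i} refl eq =
  x-y≡0⇒x≡y (trans eq (trans (cong (c *_) (ℤ.+-inverseʳ i)) (ℤ.*-zeroʳ c)))

≡-by-multiples : ∀ {l r} c d {i j k m} → i ≡ j → k ≡ m →
                 l - r ≡ c * (i - j) + d * (k - m) → l ≡ r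
≡-by-multiples c d {i} {k = k} refl refl eq = ≡-by-multiple c {i} refl (trans eq
  (trans (cong (_+_ (c * (i - i))) (trans (cong (d *_) (ℤ.+-inverseʳ k)) (ℤ.*-zeroʳ d)))
         (ℤ.+-identityʳ _)))

*-≢0 : ∀ {i j} → i ≢ 0ℤ → j ≢ 0ℤ → i * j ≢ 0ℤ
*-≢0 {i} i≢0 j≢0 = [ i≢0 , j≢0 ]′ ∘ ℤ.i*j≡0⇒i≡0∨j≡0 i

*-cancelˡ : ∀ {i j k} → i ≢ 0ℤ → i * j ≡ i * k → j ≡ k
*-cancelˡ {i} {j} {k} i≢0 = ℤ.*-cancelˡ-≡ i j k {{≢-nonZero i≢0}}

-‿≢0 : ∀ {i} → i ≢ 0ℤ → - i ≢ 0ℤ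
-‿≢0 i≢0 eq = i≢0 (ℤ.neg-injective eq)

-- Parity and powers of 2

Even : ℤ → Set
Even i = + 2 ∣ i

-- As a record type, `Odd i` determines `i` by unification; the bare `+ 2 ∣ 1ℤ + i` would not, since
-- addition computes.
record Odd (i : ℤ) : Set where
  constructor odd
  field 2∣1+i : + 2 ∣ 1ℤ + i

even+even : ∀ {i j} → Even i → Even j → Even (i + j)
even+even = ∣m∣n⇒∣m+n

even*- : ∀ {i} → Even i → ∀ j → Even (i * j)
even*- e j = ∣m⇒∣m*n j e

-*even : ∀ i {j} → Even j → Even (i * j)
-*even i = ∣n⇒∣m*n i

2*-even : ∀ i → Even (+ 2 * i)
2*-even = even*- (divides 1ℤ refl)

odd+even : ∀ {i j} → Odd i → Even j → Odd (i + j)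
odd+even {i} {j} (odd o) e = odd (subst (+ 2 ∣_) (ℤ.+-assoc 1ℤ i j) (∣m∣n⇒∣m+n o e))

even+odd : ∀ {i j} → Even i → Odd j → Odd (i + j)
even+odd {i} {j} e o = subst Odd (ℤ.+-comm j i) (odd+even o e)

odd+odd : ∀ {i j} → Odd i → Odd j → Even (i + j)
odd+odd {i} {j} (odd (divides k k≡)) (odd (divides l l≡)) =
  divides (k + l - 1ℤ) (≡-by-multiples 1ℤ 1ℤ k≡ l≡
    (solve 4 (λ i j k l → (i :+ j) :- (k :+ l :- con 1ℤ) :* con (+ 2) :=
      con 1ℤ :* ((con 1ℤ :+ i) :- k :* con (+ 2)) :+ con 1ℤ :* ((con 1ℤ :+ j) :- l :* con (+ 2)))
      refl i j k l))

even-neg : ∀ {i} → Even i → Even (- i)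
even-neg = ∣m⇒∣-m

odd-neg : ∀ {i} → Odd i → Odd (- i)
odd-neg {i} (odd (divides k k≡)) = odd (divides (1ℤ - k) (≡-by-multiple (- 1ℤ) k≡
  (solve 2 (λ i k → (con 1ℤ :+ :- i) :- (con 1ℤ :- k) :* con (+ 2) :=
    con (- 1ℤ) :* ((con 1ℤ :+ i) :- k :* con (+ 2))) refl i k)))

odd*odd : ∀ {i j} → Odd i → Odd j → Odd (i * j)
odd*odd {i} {j} (odd (divides k k≡)) (odd (divides l l≡)) =
  odd (divides (k * j - l + 1ℤ) (≡-by-multiples j (- 1ℤ) k≡ l≡
    (solve 4 (λ i j k l → (con 1ℤ :+ i :* j) :- (k :* j :- l :+ con 1ℤ) :* con (+ 2) :=
      j :* ((con 1ℤ :+ i) :- k :* con (+ 2)) :+ con (- 1ℤ) :* ((con 1ℤ :+ j) :- l :* con (+ 2)))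
      refl i j k l)))

odd⇒¬even : ∀ {i} → Odd i → Even i → ∀ {a} {A : Set a} → A
odd⇒¬even {i} (odd (divides k k≡)) (divides l l≡) =
  ⊥-elim (2≢1 (ℕ.m*n≡1⇒n≡1 ∣ k - l ∣ 2
    (trans (sym (ℤ.abs-* (k - l) (+ 2))) (cong ∣_∣ (sym 1≡)))))
  where
  2≢1 : 2 ≢ 1
  2≢1 ()
  1≡ : 1ℤ ≡ (k - l) * + 2
  1≡ = ≡-by-multiples 1ℤ (- 1ℤ) k≡ l≡
    (solve 3 (λ i k l → con 1ℤ :- (k :- l) :* con (+ 2) :=
      con 1ℤ :* ((con 1ℤ :+ i) :- k :* con (+ 2)) :+ con (- 1ℤ) :* (i :- l :* con (+ 2)))
      refl i k l)

odd⇒≢0 : ∀ {i} → Odd i → i ≢ 0ℤ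
odd⇒≢0 o refl = odd⇒¬even o (divides 0ℤ refl)

even⊎odd : ∀ i → Even i ⊎ Odd i
even⊎odd (+ n) = nonneg n
  where
  odd-1 : Odd 1ℤ
  odd-1 = odd (divides 1ℤ refl)
  nonneg : ∀ n → Even (+ n) ⊎ Odd (+ n)
  nonneg zero    = inj₁ (divides 0ℤ refl)
  nonneg (suc n) with nonneg n
  ... | inj₁ e = inj₂ (odd+even odd-1 e)
  ... | inj₂ o = inj₁ (odd+odd odd-1 o)
even⊎odd -[1+ n ] with even⊎odd (+ suc n)
... | inj₁ e = inj₁ (even-neg e)
... | inj₂ o = inj₂ (odd-neg o)

2^0∣ : ∀ i → (+ 2) ^ 0 ∣ i
2^0∣ i = divides i (sym (ℤ.*-identityʳ i))

-- Odd factors are 2-adic units. An odd `m` would make `m * o` odd, so `m` is even and one factor 2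
-- can be stripped at each step.
2^n∣m*odd⇒2^n∣m : ∀ n {m o} → Odd o → (+ 2) ^ n ∣ m * o → (+ 2) ^ n ∣ m
2^n∣m*odd⇒2^n∣m zero    {m} _ _ = 2^0∣ m
2^n∣m*odd⇒2^n∣m (suc n) {m} {o} odd-o (divides k k≡) with even⊎odd m
... | inj₂ odd-m = odd⇒¬even (odd*odd odd-m odd-o)
                    (subst Even (sym k≡) (-*even k (even*- (divides 1ℤ refl) ((+ 2) ^ n))))
... | inj₁ (divides l refl) with 2^n∣m*odd⇒2^n∣m n {l} odd-o (divides k lo≡)
  where
  lo≡ : l * o ≡ k * (+ 2) ^ n
  lo≡ = *-cancelˡ {+ 2} (λ ()) (≡-by-multiple 1ℤ k≡
    (solve 4 (λ l o k t → con (+ 2) :* (l :* o) :- con (+ 2) :* (k :* t) :=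
      con 1ℤ :* (l :* con (+ 2) :* o :- k :* (con (+ 2) :* t))) refl l o k ((+ 2) ^ n)))
...   | divides r refl = divides r
  (solve 2 (λ r t → r :* t :* con (+ 2) := r :* (con (+ 2) :* t)) refl r ((+ 2) ^ n))

n<∣2^n∣ : ∀ n → n ℕ.< ∣ (+ 2) ^ n ∣
n<∣2^n∣ zero    = ℕ.s≤s ℕ.z≤n
n<∣2^n∣ (suc n) = subst (suc n ℕ.<_) (sym (ℤ.abs-* (+ 2) ((+ 2) ^ n)))
  (ℕ.≤-trans (ℕ.+-mono-≤ (ℕ.≤-trans (ℕ.s≤s ℕ.z≤n) ih) ih)
    (ℕ.≤-reflexive (cong (∣ (+ 2) ^ n ∣ ℕ.+_) (sym (ℕ.+-identityʳ _)))))
  where ih = n<∣2^n∣ n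

-- Turns 2-adic smallness of a nonzero integer into largeness of its absolute value, which is how
-- infinitude is finally detected.
2^n∣i⇒n<∣i∣ : ∀ n {i} → i ≢ 0ℤ → (+ 2) ^ n ∣ i → n ℕ.< ∣ i ∣
2^n∣i⇒n<∣i∣ n i≢0 (divides k refl) = ℕ.<-≤-trans (n<∣2^n∣ n)
  (subst (∣ (+ 2) ^ n ∣ ℕ.≤_) (sym (ℤ.abs-* k ((+ 2) ^ n)))
    (ℕ.m≤n*m ∣ (+ 2) ^ n ∣ ∣ k ∣ {{ℕ.≢-nonZero λ ∣k∣≡0 →
      i≢0 (cong (_* (+ 2) ^ n) (ℤ.∣i∣≡0⇒i≡0 {k} ∣k∣≡0))}}))

-- Integers and fractions inside ℚ

ι : ℤ → ℚ
ι i = i / 1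

-- For a variable `i` the normalising division `i / 1` is stuck on a gcd; the constructor form
-- computes.
ι≡mkℚ : ∀ i → ι i ≡ mkℚ i 0 (Coprime.sym (1-coprimeTo _))
ι≡mkℚ i = ℚ.↥p/↧p≡p (mkℚ i 0 _)

ι-injective : ∀ {i j} → ι i ≡ ι j → i ≡ j
ι-injective {i} {j} eq = cong ↥_ (trans (sym (ι≡mkℚ i)) (trans eq (ι≡mkℚ j)))

ι-homo-+ : ∀ i j → ι (i + j) ≡ ι i ℚ.+ ι j
ι-homo-+ i j = trans (cong ι (cong₂ _+_ (sym (ℤ.*-identityʳ i)) (sym (ℤ.*-identityʳ j))))
  (sym (cong₂ ℚ._+_ (ι≡mkℚ i) (ι≡mkℚ j)))

ι-homo-* : ∀ i j → ι (i * j) ≡ ι i ℚ.* ι j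
ι-homo-* i j = sym (cong₂ ℚ._*_ (ι≡mkℚ i) (ι≡mkℚ j))

ι-≢0 : ∀ {i} → i ≢ 0ℤ → ι i ≢ 0ℚ
ι-≢0 i≢0 eq = i≢0 (ι-injective eq)

ℚ-*-cancelʳ : ∀ {p q r} → r ≢ 0ℚ → p ℚ.* r ≡ q ℚ.* r → p ≡ q
ℚ-*-cancelʳ {p} {q} {r} r≢0 eq = begin
  p                    ≡⟨ ℚ.*-identityʳ p ⟨
  p ℚ.* 1ℚ             ≡⟨ cong (p ℚ.*_) (ℚ.*-inverseʳ r) ⟨
  p ℚ.* (r ℚ.* 1/ r)   ≡⟨ ℚ.*-assoc p r (1/ r) ⟨
  p ℚ.* r ℚ.* 1/ r     ≡⟨ cong (ℚ._* 1/ r) eq ⟩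
  q ℚ.* r ℚ.* 1/ r     ≡⟨ ℚ.*-assoc q r (1/ r) ⟩
  q ℚ.* (r ℚ.* 1/ r)   ≡⟨ cong (q ℚ.*_) (ℚ.*-inverseʳ r) ⟩
  q ℚ.* 1ℚ             ≡⟨ ℚ.*-identityʳ q ⟩
  q                    ∎
  where
  open ≡-Reasoning
  instance _ = ℚ.≢-nonZero r≢0

-- Phrased as a product, so that `a / b` need not be in lowest terms and no proof of `b ≢ 0ℤ` has to
-- be carried.
record _≐_/_ (x : ℚ) (a b : ℤ) : Set where
  constructor ratio
  field numerator≡ : x ℚ.* ι b ≡ ι a

fraction : ∀ a {b} → b ≢ 0ℤ → ∃ λ x → x ≐ a / b
fraction a {b} b≢0 = ι a ℚ.÷ ι b , ratio (begin
  ι a ℚ.* 1/ ι b ℚ.* ι b     ≡⟨ ℚ.*-assoc (ι a) (1/ ι b) (ι b) ⟩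
  ι a ℚ.* (1/ ι b ℚ.* ι b)   ≡⟨ cong (ι a ℚ.*_) (ℚ.*-inverseˡ (ι b)) ⟩
  ι a ℚ.* 1ℚ                 ≡⟨ ℚ.*-identityʳ (ι a) ⟩
  ι a                        ∎)
  where
  open ≡-Reasoning
  instance _ = ℚ.≢-nonZero (ι-≢0 b≢0)

fraction-nonZero : ∀ {x a b} → a ≢ 0ℤ → x ≐ a / b → ℚ.NonZero x
fraction-nonZero {x} {b = b} a≢0 (ratio x≐) = ℚ.≢-nonZero {x} λ { refl →
  ι-≢0 a≢0 (trans (sym x≐) (ℚ.*-zeroˡ (ι b))) }

cross-multiply : ∀ {x a b} → x ≐ a / b → ↥ x * b ≡ a * ↧ x
cross-multiply {x@(mkℚ n d-1 _)} {a} {b} (ratio x≐) with ℚ.fromℚᵘ-injective {mkℚᵘ (n * b) (d-1 ℕ.* 1)} {mkℚᵘ a 0}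
    (trans (cong (x ℚ.*_) (sym (ι≡mkℚ b))) x≐)
... | *≡* eq = trans (sym (ℤ.*-identityʳ _)) (trans eq
  (cong (λ k → a * + suc k) (ℕ.*-identityʳ d-1)))

-- Clearing denominators in the equation

-- This is `a b f(a/b)`, the value of `f` cleared of denominators.
quadratic : (A B C a b : ℤ) → ℤ
quadratic A B C a b = A * (a * a) + B * (a * b) + C * (b * b)

f-value : ∀ A B C {x a b} .{{_ : ℚ.NonZero x}} → x ≐ a / b →
          f A B C x ℚ.* ι (a * b) ≡ ι (quadratic A B C a b)
f-value A B C {x} {a} {b} (ratio x≐) = begin
  f A B C x ℚ.* ι (a * b)
    ≡⟨ cong (f A B C x ℚ.*_) (trans (ι-homo-* a b) (cong (ℚ._* ι b) (sym x≐))) ⟩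
  f A B C x ℚ.* (x ℚ.* ι b ℚ.* ι b)
    ≡⟨ expand (ι A) (ι B) (ι C) x (1/ x) (ι b) ⟩
  ι A ℚ.* (x ℚ.* ι b ℚ.* (x ℚ.* ι b)) ℚ.+ ι B ℚ.* (x ℚ.* ι b ℚ.* ι b)
    ℚ.+ ι C ℚ.* (x ℚ.* 1/ x ℚ.* (ι b ℚ.* ι b))
    ≡⟨ cong₂ (λ u v → ι A ℚ.* (u ℚ.* u) ℚ.+ ι B ℚ.* (u ℚ.* ι b) ℚ.+ ι C ℚ.* v) x≐
         (trans (cong (ℚ._* (ι b ℚ.* ι b)) (ℚ.*-inverseʳ x)) (ℚ.*-identityˡ _)) ⟩
  ι A ℚ.* (ι a ℚ.* ι a) ℚ.+ ι B ℚ.* (ι a ℚ.* ι b) ℚ.+ ι C ℚ.* (ι b ℚ.* ι b)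
    ≡⟨ cong₂ ℚ._+_ (cong₂ ℚ._+_ (ι-homo A a a) (ι-homo B a b)) (ι-homo C b b) ⟨
  ι (A * (a * a)) ℚ.+ ι (B * (a * b)) ℚ.+ ι (C * (b * b))
    ≡⟨ cong (ℚ._+ ι (C * (b * b))) (ι-homo-+ (A * (a * a)) (B * (a * b))) ⟨
  ι (A * (a * a) + B * (a * b)) ℚ.+ ι (C * (b * b))
    ≡⟨ ι-homo-+ (A * (a * a) + B * (a * b)) (C * (b * b)) ⟨
  ι (quadratic A B C a b) ∎
  where
  open ≡-Reasoning
  ι-homo : ∀ i j k → ι (i * (j * k)) ≡ ι i ℚ.* (ι j ℚ.* ι k)
  ι-homo i j k = trans (ι-homo-* i (j * k)) (cong (ι i ℚ.*_) (ι-homo-* j k))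
  expand : ∀ A B C x x⁻¹ b → (A ℚ.* x ℚ.+ B ℚ.+ C ℚ.* x⁻¹) ℚ.* (x ℚ.* b ℚ.* b) ≡
    A ℚ.* (x ℚ.* b ℚ.* (x ℚ.* b)) ℚ.+ B ℚ.* (x ℚ.* b ℚ.* b) ℚ.+ C ℚ.* (x ℚ.* x⁻¹ ℚ.* (b ℚ.* b))
  expand = ℚ-Solver.solve 6 (λ A B C x x⁻¹ b →
    (A ℚ-Solver.:* x ℚ-Solver.:+ B ℚ-Solver.:+ C ℚ-Solver.:* x⁻¹) ℚ-Solver.:* (x ℚ-Solver.:* b ℚ-Solver.:* b)
    ℚ-Solver.:= A ℚ-Solver.:* (x ℚ-Solver.:* b ℚ-Solver.:* (x ℚ-Solver.:* b))
      ℚ-Solver.:+ B ℚ-Solver.:* (x ℚ-Solver.:* b ℚ-Solver.:* b)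
      ℚ-Solver.:+ C ℚ-Solver.:* (x ℚ-Solver.:* x⁻¹ ℚ-Solver.:* (b ℚ-Solver.:* b))) refl

-- Nontrivial solutions with `x = x₁/x₂` and so on, multiplied out to integers so that ring
-- identities and parity arguments apply.
record IntegerSolution (A B C x₁ x₂ y₁ y₂ z₁ z₂ : ℤ) : Set where
  F : ℤ → ℤ → ℤ
  F = quadratic A B C
  field
    x₁≢0 : x₁ ≢ 0ℤ
    x₂≢0 : x₂ ≢ 0ℤ
    y₁≢0 : y₁ ≢ 0ℤ
    y₂≢0 : y₂ ≢ 0ℤ
    z₁≢0 : z₁ ≢ 0ℤ
    z₂≢0 : z₂ ≢ 0ℤ
    equation : F x₁ x₂ * F y₁ y₂ * (z₁ * z₂ * (z₁ * z₂)) ≡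
               F z₁ z₂ * F z₁ z₂ * (x₁ * x₂ * (y₁ * y₂))
    Fx≢Fy    : F x₁ x₂ * (y₁ * y₂) ≢ F y₁ y₂ * (x₁ * x₂)
    Fz≢0     : F z₁ z₂ ≢ 0ℤ

nontrivialSolution : ∀ {A B C x₁ x₂ y₁ y₂ z₁ z₂ x y z} →
                     IntegerSolution A B C x₁ x₂ y₁ y₂ z₁ z₂ →
                     x ≐ x₁ / x₂ → y ≐ y₁ / y₂ → z ≐ z₁ / z₂ →
                     NontrivialSolution A B C x y z
nontrivialSolution {A} {B} {C} {x₁} {x₂} {y₁} {y₂} {z₁} {z₂} {x} {y} {z} s x≐ y≐ z≐ = record
  { x-nonZero = x-nonZero
  ; y-nonZero = y-nonZero
  ; z-nonZero = z-nonZero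
  ; equation = ℚ-*-cancelʳ {r = ι (X * Y * (Z * Z))} (ι-≢0 (*-≢0 (*-≢0 X≢0 Y≢0) (*-≢0 Z≢0 Z≢0))) (begin
      fx ℚ.* fy ℚ.* ι (X * Y * (Z * Z))
        ≡⟨ cong (fx ℚ.* fy ℚ.*_) ι-product ⟩
      fx ℚ.* fy ℚ.* (ι X ℚ.* ι Y ℚ.* (ι Z ℚ.* ι Z))
        ≡⟨ ℚ-Solver.solve 5 (λ u v a b c → u ⊛ v ⊛ (a ⊛ b ⊛ (c ⊛ c)) ℚ-Solver.:= u ⊛ a ⊛ (v ⊛ b) ⊛ (c ⊛ c))
             refl fx fy (ι X) (ι Y) (ι Z) ⟩
      fx ℚ.* ι X ℚ.* (fy ℚ.* ι Y) ℚ.* (ι Z ℚ.* ι Z)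
        ≡⟨ cong₂ (λ u v → u ℚ.* v ℚ.* (ι Z ℚ.* ι Z)) fx≡ fy≡ ⟩
      ι (F x₁ x₂) ℚ.* ι (F y₁ y₂) ℚ.* (ι Z ℚ.* ι Z)
        ≡⟨ ι-product′ (F x₁ x₂) (F y₁ y₂) Z Z ⟨
      ι (F x₁ x₂ * F y₁ y₂ * (Z * Z))
        ≡⟨ cong ι s.equation ⟩
      ι (F z₁ z₂ * F z₁ z₂ * (X * Y))
        ≡⟨ ι-product′ (F z₁ z₂) (F z₁ z₂) X Y ⟩
      ι (F z₁ z₂) ℚ.* ι (F z₁ z₂) ℚ.* (ι X ℚ.* ι Y)
        ≡⟨ cong (λ u → u ℚ.* u ℚ.* (ι X ℚ.* ι Y)) fz≡ ⟨
      fz ℚ.* ι Z ℚ.* (fz ℚ.* ι Z) ℚ.* (ι X ℚ.* ι Y)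
        ≡⟨ ℚ-Solver.solve 4 (λ w a b c → w ⊛ c ⊛ (w ⊛ c) ⊛ (a ⊛ b) ℚ-Solver.:= w ⊛ w ⊛ (a ⊛ b ⊛ (c ⊛ c)))
             refl fz (ι X) (ι Y) (ι Z) ⟩
      fz ℚ.* fz ℚ.* (ι X ℚ.* ι Y ℚ.* (ι Z ℚ.* ι Z))
        ≡⟨ cong (fz ℚ.* fz ℚ.*_) ι-product ⟨
      fz ℚ.* fz ℚ.* ι (X * Y * (Z * Z)) ∎)
  ; fx≢fy = λ fx≡fy → s.Fx≢Fy (ι-injective (begin
      ι (F x₁ x₂ * Y)              ≡⟨ ι-homo-* (F x₁ x₂) Y ⟩
      ι (F x₁ x₂) ℚ.* ι Y          ≡⟨ cong (ℚ._* ι Y) fx≡ ⟨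
      fx ℚ.* ι X ℚ.* ι Y           ≡⟨ cong (λ u → u ℚ.* ι X ℚ.* ι Y) fx≡fy ⟩
      fy ℚ.* ι X ℚ.* ι Y           ≡⟨ ℚ-Solver.solve 3 (λ u a b → u ⊛ a ⊛ b ℚ-Solver.:= u ⊛ b ⊛ a) refl fy (ι X) (ι Y) ⟩
      fy ℚ.* ι Y ℚ.* ι X           ≡⟨ cong (ℚ._* ι X) fy≡ ⟩
      ι (F y₁ y₂) ℚ.* ι X          ≡⟨ ι-homo-* (F y₁ y₂) X ⟨
      ι (F y₁ y₂ * X)              ∎))
  ; fz≢0  = λ fz≡0 → ι-≢0 s.Fz≢0 (trans (sym fz≡) (trans (cong (ℚ._* ι Z) fz≡0) (ℚ.*-zeroˡ (ι Z))))
  }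
  where
  open ≡-Reasoning
  module s = IntegerSolution s
  open s using (F)
  infixl 7 _⊛_
  _⊛_ : ∀ {n} → ℚ-Solver.Polynomial n → ℚ-Solver.Polynomial n → ℚ-Solver.Polynomial n
  _⊛_ = ℚ-Solver._:*_
  X = x₁ * x₂
  Y = y₁ * y₂
  Z = z₁ * z₂
  X≢0 : X ≢ 0ℤ
  X≢0 = *-≢0 s.x₁≢0 s.x₂≢0
  Y≢0 : Y ≢ 0ℤ
  Y≢0 = *-≢0 s.y₁≢0 s.y₂≢0
  Z≢0 : Z ≢ 0ℤ
  Z≢0 = *-≢0 s.z₁≢0 s.z₂≢0
  x-nonZero : ℚ.NonZero x
  x-nonZero = fraction-nonZero s.x₁≢0 x≐
  y-nonZero : ℚ.NonZero y
  y-nonZero = fraction-nonZero s.y₁≢0 y≐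
  z-nonZero : ℚ.NonZero z
  z-nonZero = fraction-nonZero s.z₁≢0 z≐
  fx = f A B C x {{x-nonZero}}
  fy = f A B C y {{y-nonZero}}
  fz = f A B C z {{z-nonZero}}
  fx≡ : fx ℚ.* ι X ≡ ι (F x₁ x₂)
  fx≡ = f-value A B C {{x-nonZero}} x≐
  fy≡ : fy ℚ.* ι Y ≡ ι (F y₁ y₂)
  fy≡ = f-value A B C {{y-nonZero}} y≐
  fz≡ : fz ℚ.* ι Z ≡ ι (F z₁ z₂)
  fz≡ = f-value A B C {{z-nonZero}} z≐
  ι-product′ : ∀ i j k l → ι (i * j * (k * l)) ≡ ι i ℚ.* ι j ℚ.* (ι k ℚ.* ι l)
  ι-product′ i j k l = trans (ι-homo-* (i * j) (k * l)) (cong₂ ℚ._*_ (ι-homo-* i j) (ι-homo-* k l))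
  ι-product = ι-product′ X Y Z Z

-- The heights in a given list have a maximum (0 for the empty list); an element of `P` of greater
-- height is not in the list.
unbounded⇒infinite : ∀ {a p} {S : Set a} {P : Pred S p} (h : S → ℕ) →
                     (∀ n → ∃ λ s → P s × n ℕ.< h s) → Infinite P
unbounded⇒infinite h unbounded xs with unbounded (max 0 (map h xs))
... | s , Ps , max<hs = s , Ps , λ s∈xs →
  ℕ.<⇒≱ max<hs (All.lookup (xs≤max 0 (map h xs)) (∈-map⁺ h s∈xs))

-- Normalisation to X + 1 + (M/N)/X

-- The substitution X = (B/A) r gives f(X) = B (r + 1 + c/r) with c = AC/B² = M/N; here this is
-- cleared of denominators.
quadratic-rescale : ∀ A B C N M → N * (A * C) ≡ M * (B * B) → ∀ a b →
                    N * quadratic A B C (B * a) (A * b) ≡ A * B * B * quadratic N N M a b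
quadratic-rescale A B C N M NAC≡MBB a b = ≡-by-multiple (A * (b * b)) NAC≡MBB
  (solve 7 (λ A B C N M a b →
    N :* (A :* (B :* a :* (B :* a)) :+ B :* (B :* a :* (A :* b)) :+ C :* (A :* b :* (A :* b)))
      :- A :* B :* B :* (N :* (a :* a) :+ N :* (a :* b) :+ M :* (b :* b))
    := A :* (b :* b) :* (N :* (A :* C) :- M :* (B :* B))) refl A B C N M a b)

rescale : ∀ {A B C N M x₁ x₂ y₁ y₂ z₁ z₂} → A ≢ 0ℤ → B ≢ 0ℤ → N ≢ 0ℤ →
          N * (A * C) ≡ M * (B * B) →
          IntegerSolution N N M x₁ x₂ y₁ y₂ z₁ z₂ →
          IntegerSolution A B C (B * x₁) (A * x₂) (B * y₁) (A * y₂) (B * z₁) (A * z₂)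
rescale {A} {B} {C} {N} {M} {x₁} {x₂} {y₁} {y₂} {z₁} {z₂} A≢0 B≢0 N≢0 NAC≡MBB s = record
  { x₁≢0 = *-≢0 B≢0 s.x₁≢0
  ; x₂≢0 = *-≢0 A≢0 s.x₂≢0
  ; y₁≢0 = *-≢0 B≢0 s.y₁≢0
  ; y₂≢0 = *-≢0 A≢0 s.y₂≢0
  ; z₁≢0 = *-≢0 B≢0 s.z₁≢0
  ; z₂≢0 = *-≢0 A≢0 s.z₂≢0
  ; equation = *-cancelˡ (*-≢0 N≢0 N≢0) (begin
      N * N * (F x₁ x₂ * F y₁ y₂ * (B * z₁ * (A * z₂) * (B * z₁ * (A * z₂))))
        ≡⟨ solve 7 (λ n u v a b c d → n :* n :* (u :* v :* (b :* c :* (a :* d) :* (b :* c :* (a :* d))))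
             := n :* u :* (n :* v) :* (a :* b :* (a :* b)) :* (c :* d :* (c :* d)))
             refl N (F x₁ x₂) (F y₁ y₂) A B z₁ z₂ ⟩
      N * F x₁ x₂ * (N * F y₁ y₂) * (A * B * (A * B)) * (z₁ * z₂ * (z₁ * z₂))
        ≡⟨ cong₂ (λ u v → u * v * (A * B * (A * B)) * (z₁ * z₂ * (z₁ * z₂))) (NF≡ x₁ x₂) (NF≡ y₁ y₂) ⟩
      A * B * B * G x₁ x₂ * (A * B * B * G y₁ y₂) * (A * B * (A * B)) * (z₁ * z₂ * (z₁ * z₂))
        ≡⟨ solve 5 (λ k u v w z → k :* u :* (k :* v) :* w :* z := k :* k :* w :* (u :* v :* z))
             refl (A * B * B) (G x₁ x₂) (G y₁ y₂) (A * B * (A * B)) (z₁ * z₂ * (z₁ * z₂)) ⟩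
      A * B * B * (A * B * B) * (A * B * (A * B)) * (G x₁ x₂ * G y₁ y₂ * (z₁ * z₂ * (z₁ * z₂)))
        ≡⟨ cong (A * B * B * (A * B * B) * (A * B * (A * B)) *_) s.equation ⟩
      A * B * B * (A * B * B) * (A * B * (A * B)) * (G z₁ z₂ * G z₁ z₂ * (x₁ * x₂ * (y₁ * y₂)))
        ≡⟨ solve 4 (λ k u w z → k :* k :* w :* (u :* u :* z) := k :* u :* (k :* u) :* w :* z)
             refl (A * B * B) (G z₁ z₂) (A * B * (A * B)) (x₁ * x₂ * (y₁ * y₂)) ⟩
      A * B * B * G z₁ z₂ * (A * B * B * G z₁ z₂) * (A * B * (A * B)) * (x₁ * x₂ * (y₁ * y₂))
        ≡⟨ cong (λ u → u * u * (A * B * (A * B)) * (x₁ * x₂ * (y₁ * y₂))) (NF≡ z₁ z₂) ⟨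
      N * F z₁ z₂ * (N * F z₁ z₂) * (A * B * (A * B)) * (x₁ * x₂ * (y₁ * y₂))
        ≡⟨ solve 8 (λ n u a b c d e f → n :* u :* (n :* u) :* (a :* b :* (a :* b)) :* (c :* d :* (e :* f))
             := n :* n :* (u :* u :* (b :* c :* (a :* d) :* (b :* e :* (a :* f)))))
             refl N (F z₁ z₂) A B x₁ x₂ y₁ y₂ ⟩
      N * N * (F z₁ z₂ * F z₁ z₂ * (B * x₁ * (A * x₂) * (B * y₁ * (A * y₂)))) ∎)
  ; Fx≢Fy = λ eq → s.Fx≢Fy (*-cancelˡ (*-≢0 (*-≢0 (*-≢0 A≢0 B≢0) B≢0) (*-≢0 A≢0 B≢0)) (begin
      A * B * B * (A * B) * (G x₁ x₂ * (y₁ * y₂))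
        ≡⟨ regroup x₁ x₂ y₁ y₂ ⟨
      N * (F x₁ x₂ * (B * y₁ * (A * y₂)))
        ≡⟨ cong (N *_) eq ⟩
      N * (F y₁ y₂ * (B * x₁ * (A * x₂)))
        ≡⟨ regroup y₁ y₂ x₁ x₂ ⟩
      A * B * B * (A * B) * (G y₁ y₂ * (x₁ * x₂)) ∎))
  ; Fz≢0 = λ eq → *-≢0 (*-≢0 (*-≢0 A≢0 B≢0) B≢0) s.Fz≢0
      (trans (sym (NF≡ z₁ z₂)) (trans (cong (N *_) eq) (ℤ.*-zeroʳ N)))
  }
  where
  open ≡-Reasoning
  module s = IntegerSolution s
  G : ℤ → ℤ → ℤ
  G = quadratic N N M
  F : ℤ → ℤ → ℤ
  F a b = quadratic A B C (B * a) (A * b)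
  NF≡ : ∀ a b → N * F a b ≡ A * B * B * G a b
  NF≡ = quadratic-rescale A B C N M NAC≡MBB
  regroup : ∀ a b c d → N * (F a b * (B * c * (A * d))) ≡ A * B * B * (A * B) * (G a b * (c * d))
  regroup a b c d = trans
    (solve 6 (λ n u a b c d → n :* (u :* (b :* c :* (a :* d))) := n :* u :* (a :* b :* (c :* d)))
      refl N (F a b) A B c d)
    (trans (cong (_* (A * B * (c * d))) (NF≡ a b))
      (solve 6 (λ k g a b c d → k :* g :* (a :* b :* (c :* d)) := k :* (a :* b) :* (g :* (c :* d)))
        refl (A * B * B) (G a b) A B c d))

-- From 2-adic approximations to infinitely many solutions

-- A solution for X + 1 + (M/N)/X whose x is 2-adically within 2⁻ⁿ of c₁/c₂ but different from it.
record Approximation (N M c₁ c₂ : ℤ) (n : ℕ) : Set where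
  field
    {x₁ x₂ y₁ y₂ z₁ z₂} : ℤ
    solution : IntegerSolution N N M x₁ x₂ y₁ y₂ z₁ z₂
    2^n∣x-c  : (+ 2) ^ n ∣ x₁ * c₂ - c₁ * x₂
    x≢c      : x₁ * c₂ - c₁ * x₂ ≢ 0ℤ
    {o}      : ℤ
    odd-o    : Odd o
    x₂≡c₂*o  : x₂ ≡ c₂ * o

-- The height depends on `x` alone: `distance x` is a numerator of x - (B/A)(c₁/c₂). It is nonzero,
-- and since `x₂` is `c₂` times an odd number, the fixed factor `A * c₂` absorbs all powers of 2
-- from the denominators. So 2ⁿ divides the height, which therefore exceeds `n`.
approximations⇒infinite :
  ∀ {A B C N M c₁ c₂} → A ≢ 0ℤ → B ≢ 0ℤ → N ≢ 0ℤ → c₂ ≢ 0ℤ →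
  N * (A * C) ≡ M * (B * B) → (∀ n → Approximation N M c₁ c₂ n) →
  Infinite (NontrivialSolutions A B C)
approximations⇒infinite {A} {B} {C} {N} {M} {c₁} {c₂} A≢0 B≢0 N≢0 c₂≢0 NAC≡MBB approx =
  unbounded⇒infinite (λ (x , _) → ∣ distance x * (A * c₂) ∣) λ n → unbounded n (approx n)
  where
  distance : ℚ → ℤ
  distance x = ↥ x * (A * c₂) - B * c₁ * ↧ x
  unbounded : ∀ n → Approximation N M c₁ c₂ n →
              ∃ λ s → NontrivialSolutions A B C s × n ℕ.< ∣ distance (proj₁ s) * (A * c₂) ∣
  unbounded n a = (proj₁ x , proj₁ y , proj₁ z)
    , nontrivialSolution S (proj₂ x) (proj₂ y) (proj₂ z)
    , 2^n∣i⇒n<∣i∣ n (*-≢0 distance≢0 (*-≢0 A≢0 c₂≢0))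
        (2^n∣m*odd⇒2^n∣m n odd-o (subst ((+ 2) ^ n ∣_) (sym distance*o≡)
          (∣n⇒∣m*n (↧ proj₁ x * (A * B)) 2^n∣x-c)))
    where
    open Approximation a
    S = rescale {C = C} A≢0 B≢0 N≢0 NAC≡MBB solution
    module S = IntegerSolution S
    x = fraction (B * x₁) S.x₂≢0
    y = fraction (B * y₁) S.y₂≢0
    z = fraction (B * z₁) S.z₂≢0
    d = distance (proj₁ x)
    δ = x₁ * c₂ - c₁ * x₂
    distance*x₂≡ : d * (A * x₂) ≡ ↧ proj₁ x * (A * B) * δ
    distance*x₂≡ = ≡-by-multiple (A * c₂) (cross-multiply (proj₂ x))
      (solve 8 (λ n e A B c₁ c₂ x₁ x₂ →
        (n :* (A :* c₂) :- B :* c₁ :* e) :* (A :* x₂) :- e :* (A :* B) :* (x₁ :* c₂ :- c₁ :* x₂)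
        := A :* c₂ :* (n :* (A :* x₂) :- B :* x₁ :* e))
        refl (↥ proj₁ x) (↧ proj₁ x) A B c₁ c₂ x₁ x₂)
    distance*o≡ : d * (A * c₂) * o ≡ ↧ proj₁ x * (A * B) * δ
    distance*o≡ = trans (trans (solve 4 (λ d A c o → d :* (A :* c) :* o := d :* (A :* (c :* o))) refl d A c₂ o)
      (cong (λ u → d * (A * u)) (sym x₂≡c₂*o))) distance*x₂≡
    distance≢0 : d ≢ 0ℤ
    distance≢0 d≡0 = *-≢0 (*-≢0 {↧ proj₁ x} (λ ()) (*-≢0 A≢0 B≢0)) x≢c
      (trans (sym distance*x₂≡) (cong (_* (A * x₂)) d≡0))

-- The descent curve h² = r⁴ - d r² + d

-- The point r = p/q, h = g/q² of h² = r⁴ − d r² + d, for d = N/M and e = d q.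
record DescentPoint (N M p q g e : ℤ) : Set where
  field
    eM≡Nq : e * M ≡ N * q
    curve : g * g ≡ p * p * (p * p) + e * q * (q * q - p * p)

-- As e = d q, the parity conditions say that v₂(r) < min(0, v₂(d)), where doubling lowers v₂(r) by
-- exactly one.
record OddPoint (N M : ℤ) (n : ℕ) : Set where
  field
    {p q g e} : ℤ
    point  : DescentPoint N M p q g e
    odd-p  : Odd p
    odd-g  : Odd g
    even-e : Even e
    even-q : Even q
    2^n∣q  : (+ 2) ^ n ∣ q
    q≢0    : q ≢ 0ℤ
  open DescentPoint point public

-- From X(2P) = ((X² − d)/(2Y))² with X = r², Y = r h; double-g is the corresponding numerator of
-- Y(2P)/r(2P).
double-p : (p q e : ℤ) → ℤ
double-p p q e = p * p * (p * p) - e * q * (q * q)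

double-g : (p q e : ℤ) → ℤ
double-g p q e = P * P * (P * P) - + 2 * (D * (P * (P * P))) + + 6 * (D * (Q * (P * P)))
                 - + 2 * (D * (D * (P * Q))) + D * Q * (D * Q)
  where
  P = p * p
  Q = q * q
  D = e * q

-- In P = p², Q = q², D = e q the curve reads g² = γ with γ = P² + D (Q - P). The quartic for the
-- double is then a polynomial identity in P, Q, D, into which g² is substituted for γ.
double : ∀ {N M p q g e} → DescentPoint N M p q g e →
         DescentPoint N M (double-p p q e) (+ 2 * (p * q * g)) (double-g p q e) (+ 2 * (p * g * e))
double {N} {M} {p} {q} {g} {e} pt = record
  { eM≡Nq = ≡-by-multiple (+ 2 * (p * g)) eM≡Nq (solve 6 (λ N M p q g e →
      con (+ 2) :* (p :* g :* e) :* M :- N :* (con (+ 2) :* (p :* q :* g))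
      := con (+ 2) :* (p :* g) :* (e :* M :- N :* q)) refl N M p q g e)
  ; curve = begin
      g′ * g′
        ≡⟨ identity (p * p) (q * q) (e * q) ⟩
      p′ * p′ * (p′ * p′) + Δ * (p * p * (p * p) + e * q * (q * q - p * p))
        * (+ 4 * (p * p * (q * q)) * (p * p * (p * p) + e * q * (q * q - p * p)) - p′ * p′)
        ≡⟨ cong (λ u → p′ * p′ * (p′ * p′) + Δ * u * (+ 4 * (p * p * (q * q)) * u - p′ * p′)) curve ⟨
      p′ * p′ * (p′ * p′) + Δ * (g * g) * (+ 4 * (p * p * (q * q)) * (g * g) - p′ * p′)
        ≡⟨ cong (λ u → p′ * p′ * (p′ * p′) + u) (solve 5 (λ p q g e r →
             con (+ 4) :* (p :* p :* (e :* q)) :* (g :* g) :* (con (+ 4) :* (p :* p :* (q :* q)) :* (g :* g) :- r :* r)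
             := con (+ 2) :* (p :* g :* e) :* (con (+ 2) :* (p :* q :* g)) :*
                (con (+ 2) :* (p :* q :* g) :* (con (+ 2) :* (p :* q :* g)) :- r :* r)) refl p q g e p′) ⟩
      p′ * p′ * (p′ * p′) + e′ * q′ * (q′ * q′ - p′ * p′) ∎
  }
  where
  open ≡-Reasoning
  open DescentPoint pt
  p′ = double-p p q e
  g′ = double-g p q e
  q′ = + 2 * (p * q * g)
  e′ = + 2 * (p * g * e)
  Δ = + 4 * (p * p * (e * q))
  identity : ∀ P Q D →
    let r = P * P - D * Q
        s = P * P * (P * P) - + 2 * (D * (P * (P * P))) + + 6 * (D * (Q * (P * P)))
              - + 2 * (D * (D * (P * Q))) + D * Q * (D * Q)
        γ = P * P + D * (Q - P)
    in s * s ≡ r * r * (r * r) + + 4 * (P * D) * γ * (+ 4 * (P * Q) * γ - r * r)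
  identity = solve 3 (λ P Q D →
    let r = P :* P :- D :* Q
        s = P :* P :* (P :* P) :- con (+ 2) :* (D :* (P :* (P :* P))) :+ con (+ 6) :* (D :* (Q :* (P :* P)))
              :- con (+ 2) :* (D :* (D :* (P :* Q))) :+ D :* Q :* (D :* Q)
        γ = P :* P :+ D :* (Q :- P)
    in s :* s := r :* r :* (r :* r) :+ con (+ 4) :* (P :* D) :* γ :* (con (+ 4) :* (P :* Q) :* γ :- r :* r))
    refl

-- Modulo 2 the new `p` and `g` are p⁴ and p⁸, while the new `q` is 2 p g times the old one.
double-oddPoint : ∀ {N M n} → OddPoint N M n → OddPoint N M (suc n)
double-oddPoint {n = n} o = record
  { point  = double point
  ; odd-p  = odd+even (odd*odd pp pp) (even-neg (even*- (-*even e even-q) (q * q)))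
  ; odd-g  = odd+even
      (odd+even
        (odd+even
          (odd+even (odd*odd (odd*odd pp pp) (odd*odd pp pp)) (even-neg (2*-even _)))
          (-*even (+ 6) (even*- even-D _)))
        (even-neg (2*-even _)))
      (even*- (even*- even-D (q * q)) _)
  ; even-e = 2*-even _
  ; even-q = 2*-even _
  ; 2^n∣q  = *-monoʳ-∣ (+ 2) (∣m⇒∣m*n g (∣n⇒∣m*n p 2^n∣q))
  ; q≢0    = *-≢0 {+ 2} (λ ()) (*-≢0 (*-≢0 (odd⇒≢0 odd-p) q≢0) (odd⇒≢0 odd-g))
  }
  where
  open OddPoint o
  pp : Odd (p * p)
  pp = odd*odd odd-p odd-p
  even-D : Even (e * q)
  even-D = -*even e even-q

oddPoints : ∀ {N M} → OddPoint N M 0 → ∀ n → OddPoint N M n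
oddPoints o zero    = o
oddPoints o (suc n) = double-oddPoint (oddPoints o n)

-- For given r the equation (r - k)² = d + r²k² is quadratic in k with discriminant 4 (r⁴ - d r² +
-- d) = (2g/q²)². The root (r + g/q²)/(1 - r²) is used as k, and the solution is x = -1/r², y =
-- -1/k², z = 1/(r k).
module _ {N M p q g e} (pt : DescentPoint N M p q g e) (q≢0 : q ≢ 0ℤ) where
  open DescentPoint pt
  -- k = κ/π, and h is up to sign q π² √(k⁴ − d k² + d): the curve in (r, k) is symmetric.
  private
    π κ h : ℤ
    π = q * q - p * p
    κ = p * q + g
    h = p * (π * π - κ * κ) - q * (κ * π)

  -- At x = -1/r², clearing denominators leaves `M` times the quartic r⁴ - d r² + d, which is a
  -- square on the curve.
  quadratic-x : quadratic N N M (- (q * q)) (p * p) ≡ M * (g * g)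
  quadratic-x = *-cancelˡ q≢0 (≡-by-multiples (q * q * (p * p - q * q)) (- (q * M)) eM≡Nq curve
    (solve 6 (λ N M p q g e →
      q :* (N :* (:- (q :* q) :* :- (q :* q)) :+ N :* (:- (q :* q) :* (p :* p)) :+ M :* (p :* p :* (p :* p)))
        :- q :* (M :* (g :* g))
      := q :* q :* (p :* p :- q :* q) :* (e :* M :- N :* q)
         :+ (:- (q :* M)) :* (g :* g :- (p :* p :* (p :* p) :+ e :* q :* (q :* q :- p :* p))))
      refl N M p q g e))

  quadratic-y : q * q * quadratic N N M (- (π * π)) (κ * κ) ≡ M * (h * h)
  quadratic-y = trans
    (≡-by-multiples (- (q * (π * π) * (π * π - κ * κ))) (- (M * π * (π * π - κ * κ))) eM≡Nq curve
      (solve 8 (λ N M p q g e π κ →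
        q :* q :* (N :* (:- (π :* π) :* :- (π :* π)) :+ N :* (:- (π :* π) :* (κ :* κ)) :+ M :* (κ :* κ :* (κ :* κ)))
          :- M :* (π :* (g :* g :- p :* p :* (p :* p)) :* (π :* π :- κ :* κ) :+ q :* q :* (κ :* κ :* (κ :* κ)))
        := (:- (q :* (π :* π) :* (π :* π :- κ :* κ))) :* (e :* M :- N :* q)
           :+ (:- (M :* π :* (π :* π :- κ :* κ))) :* (g :* g :- (p :* p :* (p :* p) :+ e :* q :* π)))
        refl N M p q g e π κ))
    (cong (M *_) (solve 3 (λ p q g →
      let π = q :* q :- p :* p
          κ = p :* q :+ g
          h = p :* (π :* π :- κ :* κ) :- q :* (κ :* π)
      in π :* (g :* g :- p :* p :* (p :* p)) :* (π :* π :- κ :* κ) :+ q :* q :* (κ :* κ :* (κ :* κ)) := h :* h)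
      refl p q g))

  -- In this form every term but the last contains `e`, so for even `e` the parity of the second
  -- factor can be read off.
  quadratic-z : quadratic N N M (q * π) (p * κ) ≡ M * (e * q * (π * π) + e * (π * (p * κ)) + p * κ * (p * κ))
  quadratic-z = ≡-by-multiple (- (q * (π * π) + π * (p * κ))) eM≡Nq
    (solve 7 (λ N M p q e π κ →
      N :* (q :* π :* (q :* π)) :+ N :* (q :* π :* (p :* κ)) :+ M :* (p :* κ :* (p :* κ))
        :- M :* (e :* q :* (π :* π) :+ e :* (π :* (p :* κ)) :+ p :* κ :* (p :* κ))
      := (:- (q :* (π :* π) :+ π :* (p :* κ))) :* (e :* M :- N :* q)) refl N M p q e π κ)

  quadratic-z′ : q * quadratic N N M (q * π) (p * κ) ≡ - (M * (g * h))
  quadratic-z′ = trans (cong (q *_) quadratic-z) (trans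
    (≡-by-multiple (- (M * (q * π + p * κ))) curve
      (solve 7 (λ M p q g e π κ →
        q :* (M :* (e :* q :* (π :* π) :+ e :* (π :* (p :* κ)) :+ p :* κ :* (p :* κ)))
          :- M :* ((g :* g :- p :* p :* (p :* p)) :* (q :* π :+ p :* κ) :+ q :* (p :* κ :* (p :* κ)))
        := (:- (M :* (q :* π :+ p :* κ))) :* (g :* g :- (p :* p :* (p :* p) :+ e :* q :* π)))
        refl M p q g e π κ))
    (solve 4 (λ M p q g →
      let π = q :* q :- p :* p
          κ = p :* q :+ g
          h = p :* (π :* π :- κ :* κ) :- q :* (κ :* π)
      in M :* ((g :* g :- p :* p :* (p :* p)) :* (q :* π :+ p :* κ) :+ q :* (p :* κ :* (p :* κ)))
         := :- (M :* (g :* h))) refl M p q g))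

  -- The three values are M g², M h²/q² and -M g h/q, so the first two multiply to the square of the
  -- third; the remaining factors agree because x y = z².
  descentPoint-equation :
    quadratic N N M (- (q * q)) (p * p) * quadratic N N M (- (π * π)) (κ * κ) * (q * π * (p * κ) * (q * π * (p * κ)))
    ≡ quadratic N N M (q * π) (p * κ) * quadratic N N M (q * π) (p * κ) * (- (q * q) * (p * p) * (- (π * π) * (κ * κ)))
  descentPoint-equation = *-cancelˡ (*-≢0 q≢0 q≢0) (begin
    q * q * (X * Y * (q * π * (p * κ) * (q * π * (p * κ))))
      ≡⟨ solve 4 (λ q x y w → q :* q :* (x :* y :* w) := x :* (q :* q :* y) :* w) refl q X Y _ ⟩
    X * (q * q * Y) * (q * π * (p * κ) * (q * π * (p * κ)))
      ≡⟨ cong₂ (λ u v → u * v * (q * π * (p * κ) * (q * π * (p * κ)))) quadratic-x quadratic-y ⟩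
    M * (g * g) * (M * (h * h)) * (q * π * (p * κ) * (q * π * (p * κ)))
      ≡⟨ solve 7 (λ M g h q p π κ →
           M :* (g :* g) :* (M :* (h :* h)) :* (q :* π :* (p :* κ) :* (q :* π :* (p :* κ)))
           := (:- (M :* (g :* h))) :* (:- (M :* (g :* h))) :* ((:- (q :* q)) :* (p :* p) :* ((:- (π :* π)) :* (κ :* κ))))
           refl M g h q p π κ ⟩
    - (M * (g * h)) * - (M * (g * h)) * (- (q * q) * (p * p) * (- (π * π) * (κ * κ)))
      ≡⟨ cong (λ u → u * u * (- (q * q) * (p * p) * (- (π * π) * (κ * κ)))) quadratic-z′ ⟨
    q * Z * (q * Z) * (- (q * q) * (p * p) * (- (π * π) * (κ * κ)))
      ≡⟨ solve 3 (λ q z w → q :* z :* (q :* z) :* w := q :* q :* (z :* z :* w)) refl q Z _ ⟩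
    q * q * (Z * Z * (- (q * q) * (p * p) * (- (π * π) * (κ * κ)))) ∎)
    where
    open ≡-Reasoning
    X = quadratic N N M (- (q * q)) (p * p)
    Y = quadratic N N M (- (π * π)) (κ * κ)
    Z = quadratic N N M (q * π) (p * κ)

-- Passing from x, y, z to c/x, c/y, c/z, which leaves f unchanged, gives x = −q²/p² → 0 2-adically.
oddPoint⇒approximation : ∀ {N M n} → M ≢ 0ℤ → OddPoint N M n → Approximation N M 0ℤ 1ℤ n
oddPoint⇒approximation {N} {M} {n} M≢0 o = record
  { solution = record
    { x₁≢0 = -‿≢0 (*-≢0 q≢0 q≢0)
    ; x₂≢0 = odd⇒≢0 pp
    ; y₁≢0 = -‿≢0 (odd⇒≢0 (odd*odd odd-π odd-π))
    ; y₂≢0 = odd⇒≢0 (odd*odd odd-κ odd-κ)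
    ; z₁≢0 = *-≢0 q≢0 (odd⇒≢0 odd-π)
    ; z₂≢0 = odd⇒≢0 (odd*odd odd-p odd-κ)
    ; equation = descentPoint-equation point q≢0
    -- Equality would give g²π²κ² = p²h². The left side is odd, whereas `h` is even because π and κ
    -- are odd and q is even.
    ; Fx≢Fy = λ eq → odd⇒¬even (odd*odd (odd*odd odd-g odd-g) (odd*odd (odd*odd odd-π odd-π) (odd*odd odd-κ odd-κ)))
        (subst Even (sym (*-cancelˡ M≢0 (Fx≡Fy⇒ eq))) (-*even (p * p) (even*- even-h h)))
    ; Fz≢0 = λ eq → *-≢0 M≢0 (odd⇒≢0 odd-Z) (trans (sym (quadratic-z point q≢0)) eq)
    }
  ; 2^n∣x-c = subst ((+ 2) ^ n ∣_) (solve 2 (λ q r → q :* (:- q) := (:- (q :* q)) :* con 1ℤ :- con 0ℤ :* r) refl q (p * p))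
      (∣m⇒∣m*n (- q) 2^n∣q)
  ; x≢c = λ eq → -‿≢0 (*-≢0 q≢0 q≢0)
      (trans (solve 2 (λ q r → (:- (q :* q)) := (:- (q :* q)) :* con 1ℤ :- con 0ℤ :* r) refl q (p * p)) eq)
  ; odd-o = pp
  ; x₂≡c₂*o = sym (ℤ.*-identityˡ (p * p))
  }
  where
  open OddPoint o
  open ≡-Reasoning
  π κ h : ℤ
  π = q * q - p * p
  κ = p * q + g
  h = p * (π * π - κ * κ) - q * (κ * π)
  pp : Odd (p * p)
  pp = odd*odd odd-p odd-p
  odd-π : Odd π
  odd-π = even+odd (-*even q even-q) (odd-neg pp)
  odd-κ : Odd κ
  odd-κ = even+odd (-*even p even-q) odd-g
  even-h : Even h
  even-h = even+even
    (-*even p (odd+odd (odd*odd odd-π odd-π) (odd-neg (odd*odd odd-κ odd-κ))))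
    (even-neg (even*- even-q (κ * π)))
  odd-Z : Odd (e * q * (π * π) + e * (π * (p * κ)) + p * κ * (p * κ))
  odd-Z = even+odd (even+even (even*- (even*- even-e q) _) (even*- even-e _))
    (odd*odd (odd*odd odd-p odd-κ) (odd*odd odd-p odd-κ))
  X = quadratic N N M (- (q * q)) (p * p)
  Y = quadratic N N M (- (π * π)) (κ * κ)
  Fx≡Fy⇒ : X * (- (π * π) * (κ * κ)) ≡ Y * (- (q * q) * (p * p)) →
           M * (g * g * (π * π * (κ * κ))) ≡ M * (p * p * (h * h))
  Fx≡Fy⇒ eq = begin
    M * (g * g * (π * π * (κ * κ)))
      ≡⟨ solve 4 (λ m g u v → m :* (g :* (u :* v)) := :- (m :* g :* ((:- u) :* v))) refl M (g * g) (π * π) (κ * κ) ⟩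
    - (M * (g * g) * (- (π * π) * (κ * κ)))
      ≡⟨ cong (λ u → - (u * (- (π * π) * (κ * κ)))) (quadratic-x point q≢0) ⟨
    - (X * (- (π * π) * (κ * κ)))
      ≡⟨ cong -_ eq ⟩
    - (Y * (- (q * q) * (p * p)))
      ≡⟨ solve 3 (λ y q p → :- (y :* ((:- q) :* p)) := p :* (q :* y)) refl Y (q * q) (p * p) ⟩
    p * p * (q * q * Y)
      ≡⟨ cong (p * p *_) (quadratic-y point q≢0) ⟩
    p * p * (M * (h * h))
      ≡⟨ solve 3 (λ m p h → p :* (m :* h) := m :* (p :* h)) refl M (p * p) (h * h) ⟩
    M * (p * p * (h * h)) ∎

-- The elliptic curve of solutions with fixed z

-- The solutions with z = c₁/c₂: the coordinates are a/q = s (x − c/z)/(x − z), with c = M/N, and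
-- b/q likewise for y.
module Fibre (N M c₁ c₂ : ℤ) where
  s t μ W V K : ℤ
  s = N * (c₁ * c₁)
  t = M * (c₂ * c₂)
  μ = s * t
  W = quadratic N N M c₁ c₂
  V = + 4 * μ + N * (c₁ * c₂) * (s + t)
  K = W * (s + t) + V

  -- The symmetry x ↦ c/x of the normalised f becomes α ↦ μ/α for α = a/q, so f is a Möbius function
  -- of u = α + μ/α, namely (W u - V)/(c₁c₂ (u - s - t)), with value f(z) at u = ∞. With v = β +
  -- μ/β, the equation follows from u + v = K/W, which is `curve` cleared of denominators.
  record FibrePoint (n : ℕ) : Set where
    field
      {a b q} : ℤ
      curve : W * ((a + b) * (a * b + μ * (q * q))) ≡ K * (a * b * q)
      odd-a : Odd a
      odd-b : Odd b
      4∣q   : + 4 ∣ q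
      2^n∣q : (+ 2) ^ n ∣ q
      q≢0   : q ≢ 0ℤ

    even-q : Even q
    even-q = ∣-trans (divides (+ 2) refl) 4∣q

    odd+μqq : ∀ {i} → Odd i → Odd (i + μ * (q * q))
    odd+μqq odd-i = odd+even odd-i (-*even μ (even*- even-q q))

    odd-μqq : ∀ {i} → Odd i → Odd (i - μ * (q * q))
    odd-μqq odd-i = odd+even odd-i (even-neg (-*even μ (even*- even-q q)))

  module _ (odd-W : Odd W) where
    -- If a = b, both sides of `curve` can be halved: the left becomes a product of odd numbers, and
    -- the right stays even because `4 ∣ q`.
    a≢b : ∀ {n} (pt : FibrePoint n) → FibrePoint.a pt ≢ FibrePoint.b pt
    a≢b pt = helper 4∣q
      where
      open FibrePoint pt
      helper : + 4 ∣ q → a ≢ b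
      helper (divides r q≡) refl = odd⇒¬even (odd*odd odd-W (odd*odd odd-a (odd+μqq (odd*odd odd-a odd-a))))
        (subst Even (sym halved) (2*-even (K * (a * a * r))))
        where
        halved : W * (a * (a * a + μ * (q * q))) ≡ + 2 * (K * (a * a * r))
        halved = *-cancelˡ {+ 2} (λ ()) (≡-by-multiples 1ℤ (K * (a * a)) curve q≡
          (solve 6 (λ W K μ a q r →
            con (+ 2) :* (W :* (a :* (a :* a :+ μ :* (q :* q)))) :- con (+ 2) :* (con (+ 2) :* (K :* (a :* a :* r)))
            := con 1ℤ :* (W :* ((a :+ a) :* (a :* a :+ μ :* (q :* q))) :- K :* (a :* a :* q))
               :+ K :* (a :* a) :* (q :- r :* con (+ 4))) refl W K μ a q r))

    -- With α = a/q and β = b/q, the double is α′ = n g, β′ = −n/g, where n = (αβ − μ)/(α − β) and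
    -- g = (α − μ/α)/(β − μ/β).
    double-fibrePoint : ∀ {n} → FibrePoint n → FibrePoint (suc n)
    double-fibrePoint {n} pt = record
      { a = k * (y * y)
      ; b = - (k * (x * x))
      ; q = q * (d * (x * y))
      ; curve = curve′
      ; odd-a = odd*odd odd-k (odd*odd odd-y odd-y)
      ; odd-b = odd-neg (odd*odd odd-k (odd*odd odd-x odd-x))
      ; 4∣q   = ∣m⇒∣m*n _ 4∣q
      -- The additional factor 2 comes from `d`, a difference of two odd numbers.
      ; 2^n∣q = 2^1+n∣ 2^n∣q (odd+odd odd-a (odd-neg odd-b))
      ; q≢0   = *-≢0 q≢0 (*-≢0 (λ d≡0 → a≢b pt (x-y≡0⇒x≡y d≡0)) (odd⇒≢0 (odd*odd odd-x odd-y)))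
      }
      where
      open FibrePoint pt
      open ≡-Reasoning
      d m k u v x y : ℤ
      d = a - b
      m = μ * (q * q)
      k = a * b - m
      u = a * a - m
      v = b * b - m
      x = a * v
      y = b * u
      odd-k : Odd k
      odd-k = odd-μqq (odd*odd odd-a odd-b)
      odd-x : Odd x
      odd-x = odd*odd odd-a (odd-μqq (odd*odd odd-b odd-b))
      odd-y : Odd y
      odd-y = odd*odd odd-b (odd-μqq (odd*odd odd-a odd-a))
      2^1+n∣ : (+ 2) ^ n ∣ q → Even d → (+ 2) ^ suc n ∣ q * (d * (x * y))
      2^1+n∣ (divides i q≡) (divides j d≡) = divides (i * j * (x * y))
        (trans (cong₂ (λ q d → q * (d * (x * y))) q≡ d≡)
          (solve 4 (λ i t j w → i :* t :* (j :* con (+ 2) :* w) := i :* j :* w :* (con (+ 2) :* t))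
            refl i ((+ 2) ^ n) j (x * y)))
      sum≡ : k * (y * y) + - (k * (x * x)) ≡ k * k * (d * ((a + b) * (a * b + m)))
      sum≡ = solve 3 (λ a b m →
        let k = a :* b :- m ; x = a :* (b :* b :- m) ; y = b :* (a :* a :- m)
        in k :* (y :* y) :+ :- (k :* (x :* x))
           := k :* k :* ((a :- b) :* ((a :+ b) :* (a :* b :+ m)))) refl a b m
      -- Since α′β′ = -n², the factor α′β′ + μ is μ - n²; this identity factors its numerator.
      mdd-kk≡-uv : m * (d * d) - k * k ≡ - (u * v)
      mdd-kk≡-uv = solve 3 (λ a b m →
        m :* ((a :- b) :* (a :- b)) :- (a :* b :- m) :* (a :* b :- m)
        := :- ((a :* a :- m) :* (b :* b :- m))) refl a b m
      product≡ : k * (y * y) * - (k * (x * x)) + μ * (q * (d * (x * y)) * (q * (d * (x * y))))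
                 ≡ x * y * (x * y) * - (u * v)
      product≡ = trans
        (solve 6 (λ μ q d k x y →
          k :* (y :* y) :* (:- (k :* (x :* x))) :+ μ :* (q :* (d :* (x :* y)) :* (q :* (d :* (x :* y))))
          := x :* y :* (x :* y) :* (μ :* (q :* q) :* (d :* d) :- k :* k)) refl μ q d k x y)
        (cong (x * y * (x * y) *_) mdd-kk≡-uv)
      curve′ : W * ((k * (y * y) + - (k * (x * x)))
                    * (k * (y * y) * - (k * (x * x)) + μ * (q * (d * (x * y)) * (q * (d * (x * y))))))
               ≡ K * (k * (y * y) * - (k * (x * x)) * (q * (d * (x * y))))
      curve′ = begin
        _ ≡⟨ cong₂ (λ i j → W * (i * j)) sum≡ product≡ ⟩
        W * (k * k * (d * ((a + b) * (a * b + m))) * (x * y * (x * y) * - (u * v)))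
          ≡⟨ solve 6 (λ W k d c z w → W :* (k :* k :* (d :* c) :* (z :* z :* (:- w)))
               := :- (k :* k :* d :* (z :* z) :* (W :* c :* w)))
               refl W k d ((a + b) * (a * b + m)) (x * y) (u * v) ⟩
        - (k * k * d * (x * y * (x * y)) * (W * ((a + b) * (a * b + m)) * (u * v)))
          ≡⟨ cong (λ i → - (k * k * d * (x * y * (x * y)) * (i * (u * v)))) curve ⟩
        - (k * k * d * (x * y * (x * y)) * (K * (a * b * q) * (u * v)))
          ≡⟨ cong (λ i → - (k * k * d * (x * y * (x * y)) * i))
               (solve 6 (λ K a b q u v → K :* (a :* b :* q) :* (u :* v) := K :* (q :* (a :* v :* (b :* u))))
                 refl K a b q u v) ⟩
        - (k * k * d * (x * y * (x * y)) * (K * (q * (x * y))))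
          ≡⟨ solve 6 (λ K k d q x y → :- (k :* k :* d :* (x :* y :* (x :* y)) :* (K :* (q :* (x :* y))))
               := K :* (k :* (y :* y) :* (:- (k :* (x :* x))) :* (q :* (d :* (x :* y)))))
               refl K k d q x y ⟩
        K * (k * (y * y) * - (k * (x * x)) * (q * (d * (x * y)))) ∎

    fibrePoints : FibrePoint 0 → ∀ n → FibrePoint n
    fibrePoints o zero    = o
    fibrePoints o (suc n) = double-fibrePoint (fibrePoints o n)

    module _ (N≢0 : N ≢ 0ℤ) (c₁≢0 : c₁ ≢ 0ℤ) (c₂≢0 : c₂ ≢ 0ℤ) (s≢t : s ≢ t) where
      -- The coordinate a/q has its pole at x = z, so a high power of 2 in `q` puts x 2-adically
      -- close to c₁/c₂. The hypothesis `s≢t` makes the Möbius map invertible.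
      fibrePoint⇒approximation : ∀ {n} → FibrePoint n → Approximation N M c₁ c₂ n
      fibrePoint⇒approximation {n} pt = record
        { solution = record
          { x₁≢0 = *-≢0 c₁≢0 (odd⇒≢0 (odd-shift t odd-a))
          ; x₂≢0 = *-≢0 c₂≢0 (odd⇒≢0 (odd-shift s odd-a))
          ; y₁≢0 = *-≢0 c₁≢0 (odd⇒≢0 (odd-shift t odd-b))
          ; y₂≢0 = *-≢0 c₂≢0 (odd⇒≢0 (odd-shift s odd-b))
          ; z₁≢0 = c₁≢0
          ; z₂≢0 = c₂≢0
          ; equation = begin
              F a * F b * (Z * Z)
                ≡⟨ cong₂ (λ x y → x * y * (Z * Z)) (F≡ a) (F≡ b) ⟩
              (W * S a - V * (a * q)) * (W * S b - V * (b * q)) * (Z * Z)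
                ≡⟨ cong (_* (Z * Z)) values≡ ⟩
              W * W * ((S a - (s + t) * (a * q)) * (S b - (s + t) * (b * q))) * (Z * Z)
                ≡⟨ solve 4 (λ w x y z → w :* w :* (x :* y) :* (z :* z) := w :* w :* (z :* x :* (z :* y)))
                     refl W (S a - (s + t) * (a * q)) (S b - (s + t) * (b * q)) Z ⟩
              W * W * (Z * (S a - (s + t) * (a * q)) * (Z * (S b - (s + t) * (b * q))))
                ≡⟨ cong₂ (λ x y → W * W * (x * y)) (D≡ a) (D≡ b) ⟨
              W * W * (D a * D b) ∎
          -- Equal values would mean α = β or αβ = μ, that is y = x or y = c/x. The first is
          -- excluded by `a≢b`, the second by parity.
          ; Fx≢Fy = λ eq → *-≢0 (*-≢0 Z≢0 (*-≢0 s-t≢0 s-t≢0)) (*-≢0 q≢0 (*-≢0 a-b≢0 (odd⇒≢0 (odd-μqq (odd*odd odd-a odd-b)))))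
              (difference≡0 eq)
          ; Fz≢0 = odd⇒≢0 odd-W
          }
        ; 2^n∣x-c = subst ((+ 2) ^ n ∣_) (sym x-c≡) (∣n⇒∣m*n (Z * (s - t)) 2^n∣q)
        ; x≢c = λ eq → *-≢0 (*-≢0 Z≢0 s-t≢0) q≢0 (trans (sym x-c≡) eq)
        ; odd-o = odd-shift s odd-a
        ; x₂≡c₂*o = refl
        }
        where
        open FibrePoint pt
        open ≡-Reasoning
        Z = c₁ * c₂
        Z≢0 : Z ≢ 0ℤ
        Z≢0 = *-≢0 c₁≢0 c₂≢0
        s-t≢0 : s - t ≢ 0ℤ
        s-t≢0 eq = s≢t (x-y≡0⇒x≡y eq)
        a-b≢0 : a - b ≢ 0ℤ
        a-b≢0 eq = a≢b pt (x-y≡0⇒x≡y eq)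
        odd-shift : ∀ i {j} → Odd j → Odd (j - i * q)
        odd-shift i odd-j = odd+even odd-j (even-neg (-*even i even-q))
        S F D : ℤ → ℤ
        S i = i * i + μ * (q * q)
        F i = quadratic N N M (c₁ * (i - t * q)) (c₂ * (i - s * q))
        D i = c₁ * (i - t * q) * (c₂ * (i - s * q))
        F≡ : ∀ i → F i ≡ W * S i - V * (i * q)
        F≡ i = solve 6 (λ N M c d q i →
          let s = N :* (c :* c) ; t = M :* (d :* d)
              x = c :* (i :- t :* q) ; y = d :* (i :- s :* q)
          in N :* (x :* x) :+ N :* (x :* y) :+ M :* (y :* y)
             := (N :* (c :* c) :+ N :* (c :* d) :+ M :* (d :* d)) :* (i :* i :+ s :* t :* (q :* q))
                :- (con (+ 4) :* (s :* t) :+ N :* (c :* d) :* (s :+ t)) :* (i :* q))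
          refl N M c₁ c₂ q i
        D≡ : ∀ i → D i ≡ Z * (S i - (s + t) * (i * q))
        D≡ i = solve 6 (λ c d s t q i →
          c :* (i :- t :* q) :* (d :* (i :- s :* q))
          := c :* d :* (i :* i :+ s :* t :* (q :* q) :- (s :+ t) :* (i :* q))) refl c₁ c₂ s t q i
        values≡ : (W * S a - V * (a * q)) * (W * S b - V * (b * q))
                  ≡ W * W * ((S a - (s + t) * (a * q)) * (S b - (s + t) * (b * q)))
        -- In terms of u and v the products u v cancel, and the difference of the two sides is (W (s
        -- + t) - V)(W (u + v) - K).
        values≡ = ≡-by-multiple (q * (W * (s + t) - V)) curve
          (solve 7 (λ W V r m a b q →
            let x = a :* a :+ m :* (q :* q) ; y = b :* b :+ m :* (q :* q)
            in (W :* x :- V :* (a :* q)) :* (W :* y :- V :* (b :* q))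
               :- W :* W :* ((x :- r :* (a :* q)) :* (y :- r :* (b :* q)))
               := q :* (W :* r :- V) :* (W :* ((a :+ b) :* (a :* b :+ m :* (q :* q))) :- (W :* r :+ V) :* (a :* b :* q)))
            refl W V (s + t) μ a b q)
        difference≡ : F a * D b - F b * D a ≡ - (Z * ((s - t) * (s - t)) * (q * ((a - b) * (a * b - μ * (q * q)))))
        difference≡ = trans
          (cong₂ _-_ (cong₂ _*_ (F≡ a) (D≡ b)) (cong₂ _*_ (F≡ b) (D≡ a)))
          (solve 7 (λ n z s t a b q →
            let m = s :* t ; x = a :* a :+ m :* (q :* q) ; y = b :* b :+ m :* (q :* q)
                W = s :+ n :+ t ; V = con (+ 4) :* m :+ n :* (s :+ t)
            in (W :* x :- V :* (a :* q)) :* (z :* (y :- (s :+ t) :* (b :* q)))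
               :- (W :* y :- V :* (b :* q)) :* (z :* (x :- (s :+ t) :* (a :* q)))
               := :- (z :* ((s :- t) :* (s :- t)) :* (q :* ((a :- b) :* (a :* b :- m :* (q :* q))))))
            refl (N * (c₁ * c₂)) Z s t a b q)
        difference≡0 : F a * D b ≡ F b * D a → Z * ((s - t) * (s - t)) * (q * ((a - b) * (a * b - μ * (q * q)))) ≡ 0ℤ
        difference≡0 eq = ℤ.neg-injective (trans (sym difference≡) (ℤ.i≡j⇒i-j≡0 eq))
        x-c≡ : c₁ * (a - t * q) * c₂ - c₁ * (c₂ * (a - s * q)) ≡ Z * (s - t) * q
        x-c≡ = solve 6 (λ c d s t q a → c :* (a :- t :* q) :* d :- c :* (d :* (a :- s :* q)) := c :* d :* (s :- t) :* q)
          refl c₁ c₂ s t q a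

-- Starting points among the multiples of r = 1

-- The second multiple of r = 1, which is r = (1 − d)/2.
oppositeParity⇒oddPoint : ∀ {N M} → M ≢ 0ℤ → Odd (M - N) → OddPoint N M 0
oppositeParity⇒oddPoint {N} {M} M≢0 odd-M-N = record
  { p = M - N
  ; q = + 2 * M
  ; g = (M - N) * (M - N) + + 2 * (M * (M - N) - + 2 * (M * M))
  ; e = + 2 * N
  ; point = record
    { eM≡Nq = solve 2 (λ N M → con (+ 2) :* N :* M := N :* (con (+ 2) :* M)) refl N M
    ; curve = solve 2 (λ N M →
        let p = M :- N ; q = con (+ 2) :* M ; e = con (+ 2) :* N
            g = p :* p :+ con (+ 2) :* (M :* p :- con (+ 2) :* (M :* M))
        in g :* g := p :* p :* (p :* p) :+ e :* q :* (q :* q :- p :* p)) refl N M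
    }
  ; odd-p = odd-M-N
  ; odd-g = odd+even (odd*odd odd-M-N odd-M-N) (2*-even _)
  ; even-e = 2*-even N
  ; even-q = 2*-even M
  ; 2^n∣q = 2^0∣ (+ 2 * M)
  ; q≢0 = *-≢0 {+ 2} (λ ()) M≢0
  }

-- The fourth multiple of r = 1.
evenHalfDifference⇒oddPoint : ∀ {N M l} → N ≡ M - + 2 * l → Odd M → Even l → l ≢ 0ℤ → OddPoint N M 0
evenHalfDifference⇒oddPoint {N} {M} {l} refl odd-M even-l l≢0 = record
  -- The point doubled here is the second multiple (1 - d)/2 = l/M.
  { point = double {p = l} {q = M} {g = g} {e = N} record
    { eM≡Nq = refl
    ; curve = solve 2 (λ M l →
        let g = l :* l :+ (l :* M :- M :* M)
        in g :* g := l :* l :* (l :* l) :+ (M :- con (+ 2) :* l) :* M :* (M :* M :- l :* l)) refl M l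
    }
  -- The parities are opposite to those in `double-oddPoint`: p = l is even, and the terms free of l
  -- are the odd ones.
  ; odd-p = even+odd (even*- even-P (l * l)) (odd-neg (odd*odd odd-D odd-Q))
  ; odd-g = even+odd
      (even+even
        (even+even
          (even+even (even*- (even*- even-P (l * l)) _) (even-neg (2*-even _)))
          (∣-trans (divides (+ 3) refl) (∣m⇒∣m*n (N * M * (M * M * (l * l * (l * l)))) (divides {+ 6} 1ℤ refl))))
        (even-neg (2*-even _)))
      (odd*odd (odd*odd odd-D odd-Q) (odd*odd odd-D odd-Q))
  ; even-e = 2*-even _
  ; even-q = 2*-even _
  ; 2^n∣q = 2^0∣ (+ 2 * (l * M * g))
  ; q≢0 = *-≢0 {+ 2} (λ ()) (*-≢0 (*-≢0 l≢0 (odd⇒≢0 odd-M)) (odd⇒≢0 odd-g))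
  }
  where
  g = l * l + (l * M - M * M)
  even-P : Even (l * l)
  even-P = even*- even-l l
  odd-Q : Odd (M * M)
  odd-Q = odd*odd odd-M odd-M
  odd-D : Odd (N * M)
  odd-D = odd*odd (odd+even odd-M (even-neg (2*-even l))) odd-M
  odd-g : Odd g
  odd-g = even+odd even-P (even+odd (even*- even-l M) (odd-neg odd-Q))

-- The third multiple of r = 1: r = (r₂² + 2r₂ − 1)/(1 − r₂²) with r₂ = l/M, numerator and denominator
-- divided by 2.
oddHalfDifference⇒oddPoint : ∀ {N M i} → N ≡ + 4 * i - M → Odd M → i ≢ 0ℤ → M - i ≢ 0ℤ → OddPoint N M 0
oddHalfDifference⇒oddPoint {N} {M} {i} refl odd-M i≢0 M-i≢0 = record
  -- The fraction r = w/s is expanded by `M` so that e = d q = N s is an integer.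
  { point = record
    { eM≡Nq = solve 3 (λ N M s → N :* s :* M := N :* (M :* s)) refl N M s
    ; curve = ≡-by-multiple (M * M * (s * s - w * w)) factor (solve 5 (λ N M l s w →
        let p = M :* w ; q = M :* s ; e = N :* s
            g = M :* (l :* (s :* s :- w :* w) :- M :* (s :* w))
        in g :* g :- (p :* p :* (p :* p) :+ e :* q :* (q :* q :- p :* p))
           := M :* M :* (s :* s :- w :* w) :*
              (l :* l :* (s :* s :- w :* w) :+ M :* M :* (w :* w)
                :- (con (+ 2) :* (l :* M :* (s :* w)) :+ N :* M :* (s :* s)))) refl N M l s w)
    }
  ; odd-p = odd*odd odd-M odd-w
  ; odd-g = odd*odd odd-M (odd+even
      (odd*odd odd-l (even+odd (even*- even-s s) (odd-neg (odd*odd odd-w odd-w))))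
      (even-neg (-*even M (even*- even-s w))))
  ; even-e = -*even N even-s
  ; even-q = -*even M even-s
  ; 2^n∣q = 2^0∣ (M * s)
  ; q≢0 = *-≢0 (odd⇒≢0 odd-M) (*-≢0 {+ 2} (λ ()) (*-≢0 i≢0 M-i≢0))
  }
  where
  -- `s` and `w` are the halves of M² - l² and l² + 2lM - M².
  l s w : ℤ
  l = M - + 2 * i
  s = + 2 * (i * (M - i))
  w = l * M - s
  even-s : Even s
  even-s = 2*-even _
  odd-l : Odd l
  odd-l = odd+even odd-M (even-neg (2*-even i))
  odd-w : Odd w
  odd-w = odd+even (odd*odd odd-l odd-M) (even-neg even-s)
  -- Divided by M²s², this is (r - r₂)² = d + r²r₂², the relation between r and k. Solving it for r₂
  -- gives the square root r₂ (1 - r²) - r, from which `g` is taken.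
  factor : l * l * (s * s - w * w) + M * M * (w * w) ≡ + 2 * (l * M * (s * w)) + N * M * (s * s)
  factor = solve 2 (λ M i →
    let N = con (+ 4) :* i :- M ; l = M :- con (+ 2) :* i ; s = con (+ 2) :* (i :* (M :- i))
        w = l :* M :- s
    in l :* l :* (s :* s :- w :* w) :+ M :* M :* (w :* w)
       := con (+ 2) :* (l :* M :* (s :* w)) :+ N :* M :* (s :* s)) refl M i

-- The exceptional values d = 1, -1, 3

-- The starting point encodes x = 10/13, y = 70/19, z = 2/5 for X + 1 + 1/X, with common value f(z)²
-- = (39/10)².
approximations[1,1] : ∀ n → Approximation 1ℤ 1ℤ (+ 2) (+ 5) n
approximations[1,1] n =
  fibrePoint⇒approximation odd-39 (λ ()) (λ ()) (λ ()) (λ ()) (fibrePoints odd-39 start n)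
  where
  open Fibre 1ℤ 1ℤ (+ 2) (+ 5)
  odd-39 : Odd (+ 39)
  odd-39 = odd (divides (+ 20) refl)
  start : FibrePoint 0
  start = record
    { a = - + 975 ; b = + 75 ; q = + 52
    ; curve = refl
    ; odd-a = odd (divides (- + 487) refl)
    ; odd-b = odd (divides (+ 38) refl)
    ; 4∣q = divides (+ 13) refl
    ; 2^n∣q = 2^0∣ (+ 52)
    ; q≢0 = λ ()
    }

-- The starting point encodes x = -11/9, y = -49/59, z = 3/7 for X + 1 - 1/X, with f(z)² = (19/21)².
approximations[1,-1] : ∀ n → Approximation 1ℤ (- 1ℤ) (+ 3) (+ 7) n
approximations[1,-1] n =
  fibrePoint⇒approximation odd-19 (λ ()) (λ ()) (λ ()) (λ ()) (fibrePoints odd-19 start n)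
  where
  open Fibre 1ℤ (- 1ℤ) (+ 3) (+ 7)
  odd-19 : Odd (- + 19)
  odd-19 = odd (divides (- + 9) refl)
  start : FibrePoint 0
  start = record
    { a = - + 1575 ; b = - + 2793 ; q = + 260
    ; curve = refl
    ; odd-a = odd (divides (- + 787) refl)
    ; odd-b = odd (divides (- + 1396) refl)
    ; 4∣q = divides (+ 65) refl
    ; 2^n∣q = 2^0∣ (+ 260)
    ; q≢0 = λ ()
    }

-- The starting point encodes x = -7/3, y = -25/93, z = -1/5 for X + 1 + 1/(3X), with f(z)² =
-- (13/15)².
approximations[3,1] : ∀ n → Approximation (+ 3) 1ℤ (- 1ℤ) (+ 5) n
approximations[3,1] n =
  fibrePoint⇒approximation odd-13 (λ ()) (λ ()) (λ ()) (λ ()) (fibrePoints odd-13 start n)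
  where
  open Fibre (+ 3) 1ℤ (- 1ℤ) (+ 5)
  odd-13 : Odd (+ 13)
  odd-13 = odd (divides (+ 7) refl)
  start : FibrePoint 0
  start = record
    { a = + 15 ; b = - + 975 ; q = + 16
    ; curve = refl
    ; odd-a = odd (divides (+ 8) refl)
    ; odd-b = odd (divides (- + 487) refl)
    ; 4∣q = divides (+ 4) refl
    ; 2^n∣q = 2^0∣ (+ 16)
    ; q≢0 = λ ()
    }

-- Lowest terms and the case distinction on d

square≡+∣square∣ : ∀ i → i * i ≡ + ∣ i * i ∣
square≡+∣square∣ (+ zero)  = refl
square≡+∣square∣ (+ suc n) = refl
square≡+∣square∣ -[1+ n ]  = refl

parities : ∀ x → (Odd (↧ x) × Odd (↥ x)) ⊎ Odd (↥ x - ↧ x)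
parities x@(mkℚ n d-1 coprime) with even⊎odd (↧ x) | even⊎odd (↥ x)
... | inj₂ odd-↧  | inj₂ odd-↥  = inj₁ (odd-↧ , odd-↥)
... | inj₂ odd-↧  | inj₁ even-↥ = inj₂ (even+odd even-↥ (odd-neg odd-↧))
... | inj₁ even-↧ | inj₂ odd-↥  = inj₂ (odd+even odd-↥ (even-neg even-↧))
... | inj₁ even-↧ | inj₁ even-↥ = ⊥-elim-irr (not-coprime coprime)
  where
  not-coprime : Coprime ∣ n ∣ (suc d-1) → ⊥
  not-coprime c with c (∣⇒∣ᵤ even-↥ , ∣⇒∣ᵤ even-↧)
  ... | ()

-- M/N is i/j² in lowest terms, so `N` and `M` are not both even. Denominators are naturals, hence ∣
-- j * j ∣.
reducedRatio : ∀ i {j} → i ≢ 0ℤ → j ≢ 0ℤ →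
               ∃₂ λ N M → N ≢ 0ℤ × M ≢ 0ℤ × N * i ≡ M * (j * j) × ((Odd N × Odd M) ⊎ Odd (M - N))
reducedRatio i {j} i≢0 j≢0 = ↧ c , ↥ c , (λ ()) , ↥c≢0 , Ni≡Mjj , parities c
  where
  instance _ = ≢-nonZero (*-≢0 j≢0 j≢0)
  c = i / ∣ j * j ∣
  g = gcd i (+ ∣ j * j ∣)
  ↥c≢0 : ↥ c ≢ 0ℤ
  ↥c≢0 ↥c≡0 = i≢0 (trans (sym (ℚ.↥-/ i ∣ j * j ∣)) (cong (_* g) ↥c≡0))
  Ni≡Mjj : ↧ c * i ≡ ↥ c * (j * j)
  Ni≡Mjj = begin
    ↧ c * i           ≡⟨ cong (↧ c *_) (ℚ.↥-/ i ∣ j * j ∣) ⟨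
    ↧ c * (↥ c * g)   ≡⟨ solve 3 (λ d n g → d :* (n :* g) := n :* (d :* g)) refl (↧ c) (↥ c) g ⟩
    ↥ c * (↧ c * g)   ≡⟨ cong (↥ c *_) (trans (ℚ.↧-/ i ∣ j * j ∣) (sym (square≡+∣square∣ j))) ⟩
    ↥ c * (j * j)     ∎
    where open ≡-Reasoning

module _ {A B C : ℤ} (A≢0 : A ≢ 0ℤ) (B≢0 : B ≢ 0ℤ) where
  oddPoint⇒infinite : ∀ {N M} → N ≢ 0ℤ → M ≢ 0ℤ → N * (A * C) ≡ M * (B * B) →
                      OddPoint N M 0 → Infinite (NontrivialSolutions A B C)
  oddPoint⇒infinite N≢0 M≢0 NAC≡MBB o = approximations⇒infinite A≢0 B≢0 N≢0 (λ ()) NAC≡MBB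
    λ n → oddPoint⇒approximation M≢0 (oddPoints o n)

  -- Only the ratio of `N` to `M` matters, so approximations found for explicit numbers `n`, `m`
  -- serve every proportional pair.
  proportional⇒infinite : ∀ {N M c₁ c₂} n m → n ≢ 0ℤ → c₂ ≢ 0ℤ → N ≢ 0ℤ → M ≢ 0ℤ → n * M ≡ N * m →
                          N * (A * C) ≡ M * (B * B) →
                          (∀ k → Approximation n m c₁ c₂ k) →
                          Infinite (NontrivialSolutions A B C)
  proportional⇒infinite {N} {M} n m n≢0 c₂≢0 N≢0 M≢0 nM≡Nm NAC≡MBB =
    approximations⇒infinite A≢0 B≢0 n≢0 c₂≢0 (*-cancelˡ N≢0 (≡-by-multiples n (B * B) NAC≡MBB nM≡Nm
      (solve 6 (λ N M n m x y → N :* (n :* x) :- N :* (m :* y)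
        := n :* (N :* x :- M :* y) :+ y :* (n :* M :- N :* m)) refl N M n m (A * C) (B * B))))

  -- With 2l = M - N, the second multiple of r = 1 is l/M. For even l the fourth multiple serves,
  -- for odd l the third, with 2i = M - l. The excluded values l = 0, i = 0 and i = M are d = 1, -1
  -- and 3.
  bothOdd⇒infinite : ∀ {N M} → Odd N → Odd M → N * (A * C) ≡ M * (B * B) →
                     Infinite (NontrivialSolutions A B C)
  bothOdd⇒infinite {N} {M} odd-N odd-M NAC≡MBB with odd+odd odd-M (odd-neg odd-N)
  ... | divides l M-N≡ with even⊎odd l
  ...   | inj₁ even-l with l ℤ.≟ 0ℤ
  ...     | no l≢0   = oddPoint⇒infinite (odd⇒≢0 odd-N) (odd⇒≢0 odd-M) NAC≡MBB
    (evenHalfDifference⇒oddPoint N≡M-2l odd-M even-l l≢0)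
    where
    N≡M-2l : N ≡ M - + 2 * l
    N≡M-2l = ≡-by-multiple (- 1ℤ) M-N≡ (solve 3 (λ N M l →
      N :- (M :- con (+ 2) :* l) := con (- 1ℤ) :* (M :- N :- l :* con (+ 2))) refl N M l)
  ...     | yes refl = proportional⇒infinite 1ℤ 1ℤ (λ ()) (λ ()) (odd⇒≢0 odd-N) (odd⇒≢0 odd-M)
    (≡-by-multiple 1ℤ M-N≡ (solve 2 (λ N M →
      con 1ℤ :* M :- N :* con 1ℤ := con 1ℤ :* (M :- N :- con 0ℤ)) refl N M)) NAC≡MBB approximations[1,1]
  bothOdd⇒infinite {N} {M} odd-N odd-M NAC≡MBB | divides l M-N≡ | inj₂ odd-l with odd+odd odd-M (odd-neg odd-l)
  ... | divides i M-l≡ with i ℤ.≟ 0ℤ | M - i ℤ.≟ 0ℤ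
  ...   | no i≢0   | no M-i≢0 = oddPoint⇒infinite (odd⇒≢0 odd-N) (odd⇒≢0 odd-M) NAC≡MBB
    (oddHalfDifference⇒oddPoint N≡4i-M odd-M i≢0 M-i≢0)
    where
    N≡4i-M : N ≡ + 4 * i - M
    N≡4i-M = ≡-by-multiples (- 1ℤ) (+ 2) M-N≡ M-l≡ (solve 4 (λ N M l i →
      N :- (con (+ 4) :* i :- M) :=
      con (- 1ℤ) :* (M :- N :- l :* con (+ 2)) :+ con (+ 2) :* (M :- l :- i :* con (+ 2))) refl N M l i)
  ...   | yes refl | _ = proportional⇒infinite 1ℤ (- 1ℤ) (λ ()) (λ ()) (odd⇒≢0 odd-N) (odd⇒≢0 odd-M)
    (≡-by-multiples (- 1ℤ) (+ 2) M-N≡ M-l≡ (solve 3 (λ N M l →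
      con 1ℤ :* M :- N :* con (- 1ℤ) :=
      con (- 1ℤ) :* (M :- N :- l :* con (+ 2)) :+ con (+ 2) :* (M :- l :- con 0ℤ)) refl N M l))
    NAC≡MBB approximations[1,-1]
  ...   | no _ | yes M-i≡0 with x-y≡0⇒x≡y {M} {i} M-i≡0
  ...     | refl = proportional⇒infinite (+ 3) 1ℤ (λ ()) (λ ()) (odd⇒≢0 odd-N) (odd⇒≢0 odd-M)
    (≡-by-multiples 1ℤ (- + 2) M-N≡ M-l≡ (solve 3 (λ N M l →
      con (+ 3) :* M :- N :* con 1ℤ :=
      con 1ℤ :* (M :- N :- l :* con (+ 2)) :+ con (- + 2) :* (M :- l :- M :* con (+ 2))) refl N M l))
    NAC≡MBB approximations[3,1]

theorem1p3 : (A B C : ℤ) → A * B * C ≢ 0ℤ → Infinite (NontrivialSolutions A B C)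
theorem1p3 A B C ABC≢0 = byParity (reducedRatio (A * C) (*-≢0 A≢0 C≢0) B≢0)
  where
  A≢0 : A ≢ 0ℤ
  A≢0 refl = ABC≢0 refl
  B≢0 : B ≢ 0ℤ
  B≢0 refl = ABC≢0 (cong (_* C) (ℤ.*-zeroʳ A))
  C≢0 : C ≢ 0ℤ
  C≢0 refl = ABC≢0 (ℤ.*-zeroʳ (A * B))
  byParity : (∃₂ λ N M → N ≢ 0ℤ × M ≢ 0ℤ × N * (A * C) ≡ M * (B * B) × ((Odd N × Odd M) ⊎ Odd (M - N))) →
             Infinite (NontrivialSolutions A B C)
  byParity (_ , _ , _ , _ , NAC≡MBB , inj₁ (odd-N , odd-M)) =
    bothOdd⇒infinite A≢0 B≢0 odd-N odd-M NAC≡MBB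
  byParity (_ , _ , N≢0 , M≢0 , NAC≡MBB , inj₂ odd-M-N) =
    oddPoint⇒infinite A≢0 B≢0 N≢0 M≢0 NAC≡MBB (oppositeParity⇒oddPoint M≢0 odd-M-N)
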